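{- There exists a computable function $C_5\colon\mathbb N\to(0,\tfrac12)$ such that if an infinite word $W$ satisfies: (1) $C_{rec}$ is a recurrence bound for $W$; (2) some factor $u$ of $W$ occurs in $W$ twice with a shift (distance between the starting positions of the two occurrences) smaller than $C_5(C_{rec})|u|$, then $W$ is periodic with period length equal to this shift.
   Context: For a uniformly recurrent infinite word $W$, $P_2(N)$ is the least number such that every factor of $W$ of length $P_2(N)$ contains all factors of $W$ of length $N$; $C$ is a recurrence bound for $W$ if $P_2(N)\le CN$ for all $N$. $W$ is periodic with period length $p$ if $W=uuu\cdots$ for a word $u$ of length $p$. -}

module Defs where

open import Data.Nat using (ℕ; _+_; _*_; _≤_; _<_)
open import Data.Product using (Σ; _×_; ∃-syntax)
open import Relation.Binary.PropositionalEquality using (_≡_)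

Word : Set → Set
Word A = ℕ → A

-- The factor of W of length N starting at position j occurs in W starting at position k.
OccursAt : {A : Set} → Word A → (j N k : ℕ) → Set
OccursAt W j N k = ∀ t → t < N → W (k + t) ≡ W (j + t)

ContainsAllFactors : {A : Set} → Word A → (i L N : ℕ) → Set
ContainsAllFactors W i L N =
  ∀ j → ∃[ k ] (i ≤ k × k + N ≤ i + L × OccursAt W j N k)

-- C is a recurrence bound for W:  P₂(N) ≤ C·N for all N, i.e. every factor of
-- W of length C·N contains all factors of W of length N.
RecurrenceBound : {A : Set} → ℕ → Word A → Set
RecurrenceBound C W = ∀ N i → ContainsAllFactors W i (C * N) N

PeriodicWithPeriod : {A : Set} → ℕ → Word A → Set
PeriodicWithPeriod p W = ∀ m → W (m + p) ≡ W m

-- Proof idea: the two occurrences of u at distance s make W locally s-periodic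
-- on the window [i, i + n).  With N = s + 1, the recurrence bound places a copy
-- of every factor W[m, m + s] inside W[i, i + C·(s + 1)), which lies in that
-- window once C·(s + 1) ≤ n + s; hence W(m + s) = W m for every m.  The choice
-- C₅ C = 1 / (2C + 3) guarantees C·(s + 1) ≤ n + s whenever s < C₅ C · n.
module Submission where

open import Defs
open import Data.Nat using (ℕ; _+_; _≤_)
open import Data.Integer using (+_)
open import Data.Rational using (ℚ; _/_; _*_; _<_; 0ℚ; ½)
open import Data.Product using (Σ; _×_)

open import Data.Nat as ℕ using (suc; s≤s; z≤n)
import Data.Nat.Properties as ℕP
open import Algebra.Properties.CommutativeSemigroup ℕP.+-commutativeSemigroup using (xy∙z≈xz∙y)
open import Data.Nat.Tactic.RingSolver using (solve-∀)
import Data.Integer as ℤ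
import Data.Integer.Properties as ℤP
open import Data.Rational using (toℚᵘ)
open import Data.Rational.Properties using (toℚᵘ-fromℚᵘ; toℚᵘ-homo-*; toℚᵘ-mono-<; toℚᵘ-cancel-<)
import Data.Rational.Unnormalised as ℚᵘ
import Data.Rational.Unnormalised.Properties as ℚᵘP
open import Data.Product using (_,_)
open import Relation.Binary.PropositionalEquality

occursAt-shift⇒periodic-on : {A : Set} (W : Word A) {i n s x : ℕ} →
  OccursAt W i n (i + s) → i ≤ x → ℕ._<_ x (i + n) → W (x + s) ≡ W x
occursAt-shift⇒periodic-on W {i} {n} {s} occ i≤x x<i+n with ℕP.≤⇒≤″ i≤x
... | record { quotient = t ; equality = refl } =
  trans (cong W (xy∙z≈xz∙y i t s)) (occ t (ℕP.+-cancelˡ-< i t n x<i+n))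

factor-start-in-window : {i k n C s : ℕ} →
  k + suc s ≤ i + C ℕ.* suc s → C ℕ.* suc s ≤ n + s → ℕ._<_ k (i + n)
factor-start-in-window {i} {k} {n} {C} {s} k+s<i+Cs Cs≤n+s =
  ℕP.+-cancelʳ-≤ s (suc k) (i + n) (begin
    suc k + s       ≡⟨ ℕP.+-suc k s ⟨
    k + suc s       ≤⟨ k+s<i+Cs ⟩
    i + C ℕ.* suc s ≤⟨ ℕP.+-monoʳ-≤ i Cs≤n+s ⟩
    i + (n + s)     ≡⟨ ℕP.+-assoc i n s ⟨
    i + n + s       ∎)
  where open ℕP.≤-Reasoning

repetition-within-recurrence⇒periodic : {A : Set} (W : Word A) {C i n s : ℕ} →
  RecurrenceBound C W → OccursAt W i n (i + s) → C ℕ.* suc s ≤ n + s →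
  PeriodicWithPeriod s W
repetition-within-recurrence⇒periodic W {C} {i} {n} {s} rb occ Cs≤n+s m
  with rb (suc s) i m
... | k , i≤k , k+s<i+Cs , copy = begin
  W (m + s)  ≡⟨ copy s (ℕP.n<1+n s) ⟨
  W (k + s)  ≡⟨ occursAt-shift⇒periodic-on W occ i≤k k<i+n ⟩
  W k        ≡⟨ cong W (ℕP.+-identityʳ k) ⟨
  W (k + 0)  ≡⟨ copy 0 (s≤s z≤n) ⟩
  W (m + 0)  ≡⟨ cong W (ℕP.+-identityʳ m) ⟩
  W m        ∎
  where
  open ≡-Reasoning
  k<i+n : ℕ._<_ k (i + n)
  k<i+n = factor-start-in-window {C = C} k+s<i+Cs Cs≤n+s

nat<ℚᵘ-fraction⇒*< : (s n k : ℕ) →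
  ℚᵘ.mkℚᵘ (+ s) 0 ℚᵘ.< ℚᵘ.mkℚᵘ (+ n) k → ℕ._<_ (s ℕ.* suc k) n
nat<ℚᵘ-fraction⇒*< s n k (ℚᵘ.*<* s*k<n*1) =
  ℤP.drop‿+<+ (subst₂ ℤ._<_ (sym (ℤP.pos-* s (suc k))) (ℤP.*-identityʳ (+ n)) s*k<n*1)

toℚᵘ-recip*nat : (k n : ℕ) → toℚᵘ (+ 1 / suc k * (+ n / 1)) ℚᵘ.≃ ℚᵘ.mkℚᵘ (+ n) k
toℚᵘ-recip*nat k n = ℚᵘP.≃-trans (toℚᵘ-homo-* (+ 1 / suc k) (+ n / 1))
  (ℚᵘP.≃-trans (ℚᵘP.*-cong (toℚᵘ-fromℚᵘ (ℚᵘ.mkℚᵘ (+ 1) k)) (toℚᵘ-fromℚᵘ (ℚᵘ.mkℚᵘ (+ n) 0)))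
    (ℚᵘ.*≡* (cong₂ ℤ._*_ (ℤP.*-identityˡ (+ n)) (cong +_ (sym (ℕP.*-identityʳ (suc k)))))))

nat<recip*nat⇒*< : (s n k : ℕ) → + s / 1 < + 1 / suc k * (+ n / 1) → ℕ._<_ (s ℕ.* suc k) n
nat<recip*nat⇒*< s n k lt = nat<ℚᵘ-fraction⇒*< s n k
  (ℚᵘP.<-respʳ-≃ (toℚᵘ-recip*nat k n)
    (ℚᵘP.<-respˡ-≃ (toℚᵘ-fromℚᵘ (ℚᵘ.mkℚᵘ (+ s) 0)) (toℚᵘ-mono-< lt)))

0<recip : (k : ℕ) → 0ℚ < + 1 / suc k
0<recip k = toℚᵘ-cancel-<
  (ℚᵘP.<-respʳ-≃ (ℚᵘP.≃-sym (toℚᵘ-fromℚᵘ (ℚᵘ.mkℚᵘ (+ 1) k))) (ℚᵘ.*<* (ℤ.+<+ (s≤s z≤n))))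

recip<½ : (k : ℕ) → + 1 / (3 + k) < ½
recip<½ k = toℚᵘ-cancel-<
  (ℚᵘP.<-respˡ-≃ (ℚᵘP.≃-sym (toℚᵘ-fromℚᵘ (ℚᵘ.mkℚᵘ (+ 1) (2 + k))))
    (ℚᵘ.*<* (ℤ.+<+ (s≤s (s≤s (s≤s z≤n))))))

C₅ : ℕ → ℚ
C₅ C = + 1 / (3 + 2 ℕ.* C)

recurrence-window≤shift*denominator : (C s : ℕ) → 1 ≤ s → C ℕ.* suc s ≤ s ℕ.* (3 + 2 ℕ.* C)
recurrence-window≤shift*denominator C (suc s) _ =
  subst (C ℕ.* suc (suc s) ≤_) (sym (expand C s)) (ℕP.m≤m+n _ _)
  where
  expand : ∀ C s → suc s ℕ.* (3 + 2 ℕ.* C) ≡ C ℕ.* suc (suc s) + (C ℕ.* s + 3 ℕ.* suc s)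
  expand = solve-∀

shift<C₅*length⇒periodic : {A : Set} (W : Word A) {C i n s : ℕ} →
  RecurrenceBound C W → 1 ≤ s → OccursAt W i n (i + s) →
  + s / 1 < C₅ C * (+ n / 1) → PeriodicWithPeriod s W
shift<C₅*length⇒periodic W {C} {i} {n} {s} rb 1≤s occ s<C₅n =
  repetition-within-recurrence⇒periodic W {C} rb occ (begin
    C ℕ.* suc s          ≤⟨ recurrence-window≤shift*denominator C s 1≤s ⟩
    s ℕ.* (3 + 2 ℕ.* C)  <⟨ nat<recip*nat⇒*< s n (2 + 2 ℕ.* C) s<C₅n ⟩
    n                    ≤⟨ ℕP.m≤m+n n s ⟩
    n + s                ∎)
  where open ℕP.≤-Reasoning

lemma10 : Σ (ℕ → ℚ) λ C₅ →
    ((c : ℕ) → 0ℚ < C₅ c × C₅ c < ½) ×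
    ((A : Set) (W : Word A) (Crec : ℕ) → RecurrenceBound Crec W →
      (i n s : ℕ) → 1 ≤ s → OccursAt W i n (i + s) →
      (+ s / 1) < C₅ Crec * (+ n / 1) →
      PeriodicWithPeriod s W)
lemma10 =
  C₅ ,
  (λ C → 0<recip (2 + 2 ℕ.* C) , recip<½ (2 ℕ.* C)) ,
  (λ A W C rb i n s → shift<C₅*length⇒periodic W {C} rb)
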